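{- Let $q=2v+1$ be a prime power where $v=k_1k_2\cdots k_r$ with $k_1,\dots,k_r$ pairwise coprime odd integers, each $k_i\ge 3$. Then there exists a $(v,\{k_1,\dots,k_r\})$ Heffter space over the additive group of $\mathbb F_q$.
   Context: A half-set of an abelian group $G$ of odd order $2v+1\ge7$ is a subset $V\subseteq G\setminus\{0\}$ containing exactly one element of each pair $\{g,-g\}$, $g\ne0$. A $(v,k)$ Heffter system on $V$ is a partition of $V$ into blocks of size $k$, each summing to $0$ in $G$. A $(v,\{k_1,\dots,k_r\})$ Heffter space over $G$ is a partial linear space (any two distinct points lie in at most one block) with point set a half-set $V$ of $G$, together with a resolution of its blocks into $r$ parallel classes $\mathcal P_1,\dots,\mathcal P_r$ (each a partition of $V$), where $\mathcal P_i$ is a $(v,k_i)$ Heffter system. -}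

module Defs where

open import Level using (Level; _⊔_) renaming (suc to lsuc)
open import Algebra.Bundles using (AbelianGroup; CommutativeRing)
import Algebra.Properties.CommutativeMonoid.Sum as Sum
open import Data.Fin.Base using (Fin)
open import Data.Nat.Base using (ℕ; _+_; _*_; _^_; _≤_)
open import Data.Nat.Coprimality using (Coprime)
open import Data.Nat.Primality using (Prime)
open import Data.Product.Base using (Σ; ∃; ∃₂; _×_; _,_; proj₁)
open import Data.Sum.Base using (_⊎_)
open import Data.Vec.Functional using (Vector; foldr)
open import Function.Bundles using (Inverse)
open import Function.Definitions using (Injective)
open import Relation.Binary.Bundles using (Setoid)
open import Relation.Binary.PropositionalEquality.Core using (_≡_; _≢_)
import Relation.Binary.PropositionalEquality.Properties as ≡
open import Relation.Nullary.Negation.Core using (¬_)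

∏ : ∀ {r} → Vector ℕ r → ℕ
∏ = foldr _*_ 1

PairwiseCoprime : ∀ {r} → Vector ℕ r → Set
PairwiseCoprime k = ∀ i j → i ≢ j → Coprime (k i) (k j)

IsPrimePower : ℕ → Set
IsPrimePower q = ∃₂ λ p n → Prime p × 1 ≤ n × q ≡ p ^ n

HasCardinality : ∀ {c ℓ} → Setoid c ℓ → ℕ → Set (c ⊔ ℓ)
HasCardinality S n = Inverse S (≡.setoid (Fin n))

record Field c ℓ : Set (lsuc (c ⊔ ℓ)) where
  field
    commutativeRing : CommutativeRing c ℓ
  open CommutativeRing commutativeRing public
    using (Carrier; _≈_; _≉_; 0#; 1#; setoid; +-abelianGroup)
    renaming (_*_ to _·_)
  field
    0≉1     : 0# ≉ 1#
    inverse : ∀ x → x ≉ 0# → ∃ λ y → x · y ≈ 1#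

module _ {c ℓ} (G : AbelianGroup c ℓ) where
  open AbelianGroup G using (Carrier; _≈_; _≉_; ε; setoid; commutativeMonoid)
    renaming (_⁻¹ to -_)

  -- A subset with exactly n elements, given by listing them in some order;
  -- the order is irrelevant to everything below.
  record FinSubset (n : ℕ) : Set (c ⊔ ℓ) where
    field
      elements : Vector Carrier n
      distinct : Injective _≡_ _≈_ elements

    sum : Carrier
    sum = Sum.sum commutativeMonoid elements

  open FinSubset

  infix 4 _∈_ _∉_

  _∈_ : ∀ {n} → Carrier → FinSubset n → Set ℓ
  x ∈ S = ∃ λ i → x ≈ elements S i

  _∉_ : ∀ {n} → Carrier → FinSubset n → Set ℓ
  x ∉ S = ¬ (x ∈ S)

  record IsHalfSet {v : ℕ} (V : FinSubset v) : Set (c ⊔ ℓ) where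
    field
      order   : HasCardinality setoid (2 * v + 1)
      order≥7 : 7 ≤ 2 * v + 1
      ε∉V     : ε ∉ V
      oneOf±  : ∀ g → g ≉ ε → (g ∈ V × - g ∉ V) ⊎ (g ∉ V × - g ∈ V)

  record HeffterSystem {v : ℕ} (V : FinSubset v) (k : ℕ) : Set (c ⊔ ℓ) where
    field
      size     : ℕ
      block    : Fin size → FinSubset k
      block⊆V  : ∀ a {x} → x ∈ block a → x ∈ V
      covering : ∀ {x} → x ∈ V → ∃ λ a → x ∈ block a
      disjoint : ∀ {x} a b → x ∈ block a → x ∈ block b → a ≡ b
      zeroSum  : ∀ a → sum (block a) ≈ ε

  -- The blocks of the whole space are indexed by pairs (i , a): the a-th block
  -- of the i-th parallel class.  Since a resolution puts every block in
  -- exactly one class, different pairs stand for different blocks.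
  record HeffterSpace {r : ℕ} (v : ℕ) (k : Vector ℕ r) : Set (c ⊔ ℓ) where
    field
      V             : FinSubset v
      isHalfSet     : IsHalfSet V
      parallelClass : ∀ i → HeffterSystem V (k i)

    BlockIndex : Set
    BlockIndex = Σ (Fin r) λ i → Fin (HeffterSystem.size (parallelClass i))

    blockAt : (B : BlockIndex) → FinSubset (k (proj₁ B))
    blockAt (i , a) = HeffterSystem.block (parallelClass i) a

    field
      partialLinear : ∀ {x y} → x ≉ y → (B C : BlockIndex) →
                      x ∈ blockAt B → y ∈ blockAt B →
                      x ∈ blockAt C → y ∈ blockAt C → B ≡ C

{-# OPTIONS --safe #-}
module Submission where

-- Fˣ contains an element w of order v: Fermat's theorem and the bound on the number of roots of
-- X^d - 1 give an element of every prime power order dividing 2v, and orders that are coprime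
-- multiply. The powers of w, i.e. the v-th roots of unity, form a half-set because v is odd and
-- -1 ≠ 1. The i-th parallel class consists of the cosets in it of the group of kᵢ-th roots of
-- unity: they sum to 0 as geometric sums, and two points in a common coset for i and for j ≠ i
-- have a quotient whose order divides both kᵢ and kⱼ, so they coincide.

open import Defs
open import Algebra.Bundles using (CommutativeRing)
import Algebra.Properties.CommutativeMonoid.Sum as CommutativeMonoidSum
import Algebra.Properties.CommutativeSemiring.Exp as CommutativeSemiringExp
import Algebra.Properties.Ring as RingProperties
import Algebra.Solver.Ring.NaturalCoefficients.Default as NaturalCoefficients
open import Data.Fin.Base as Fin using (Fin; zero; suc; toℕ; cast; combine; punchIn)
import Data.Fin.Permutation as Perm
import Data.Fin.Properties as Fin
open import Data.List.Base using ([]; _∷_)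
open import Data.List.Relation.Unary.All using (_∷_)
import Data.Nat.Base as ℕ
open import Data.Nat.Base using (ℕ; zero; suc; _+_; _*_; _∸_; _≤_; _<_; z≤n; s≤s; NonZero)
open import Data.Nat.Coprimality using (Coprime; coprime-divisor; coprime-Bézout)
import Data.Nat.Coprimality as Coprimality
open import Data.Nat.Divisibility
open import Data.Nat.DivMod using (m%n<n; m≡m%n+[m/n]*n)
open import Data.Nat.GCD using (gcd; gcd-GCD; gcd[m,n]∣m; gcd[m,n]∣n; module Bézout)
open import Data.Nat.Induction using (<-rec)
open import Data.Nat.Primality using (Prime; prime⇒nonZero; prime⇒nonTrivial; prime⇒irreducible; euclidsLemma; prime[2])
open import Data.Nat.Primality.Factorisation using (factorise)
import Data.Nat.Properties as ℕ
open import Data.Product.Base using (Σ; ∃; ∃₂; _×_; _,_; proj₁; proj₂)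
open import Data.Sum.Base using (_⊎_; inj₁; inj₂; [_,_]′)
open import Data.Vec.Base using (Vec; []; _∷_; replicate)
open import Data.Vec.Functional using (Vector)
import Data.Vec.Functional as Vector
open import Function.Base using (_∘_; id)
open import Function.Bundles using (module Inverse)
open import Function.Definitions using (Injective)
open import Relation.Binary.Definitions using (Decidable)
open import Relation.Binary.PropositionalEquality as ≡ using (_≡_)
open import Relation.Nullary.Decidable.Core using (yes; no; map′)
open import Relation.Nullary.Negation.Core using (contradiction)

-- Divisibility and coprimality of natural numbers.

∃-primeDivisor : ∀ n → 2 ≤ n → ∃ λ p → Prime p × p ∣ n
∃-primeDivisor n@(suc _) 2≤n with factorise n
... | record { factors = [] ; isFactorisation = n≡1 } =
  contradiction (≡.subst (2 ≤_) n≡1 2≤n) λ { (s≤s ()) }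
... | record { factors = p ∷ ps ; isFactorisation = n≡p*ps ; factorsPrime = pr ∷ _ } =
  p , pr , ≡.subst (p ∣_) (≡.sym n≡p*ps) (m∣m*n _)

splitPrimePart : ∀ {p} → Prime p → ∀ n → .{{NonZero n}} → ∃₂ λ a m → n ≡ p ℕ.^ a * m × p ∤ m
splitPrimePart {p} pr = <-rec (λ n → .{{NonZero n}} → ∃₂ λ a m → n ≡ p ℕ.^ a * m × p ∤ m) step
  where
  instance _ = prime⇒nonTrivial pr
  step : ∀ n → (∀ {m} → m < n → .{{NonZero m}} → ∃₂ λ a l → m ≡ p ℕ.^ a * l × p ∤ l) →
         .{{NonZero n}} → ∃₂ λ a m → n ≡ p ℕ.^ a * m × p ∤ m
  step n rec with p ∣? n
  ... | no p∤n = 0 , n , ≡.sym (ℕ.*-identityˡ n) , p∤n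
  -- A zero quotient would make `n` zero, so only a successor remains; it is smaller than `n`
  -- because `p` exceeds 1.
  ... | yes (divides-refl (suc m)) with rec (ℕ.m<m*n (suc m) p (ℕ.nonTrivial⇒n>1 p))
  ...   | a , l , m≡ , p∤l = suc a , l , (begin
      suc m * p          ≡⟨ ℕ.*-comm (suc m) p ⟩
      p * suc m          ≡⟨ ≡.cong (p *_) m≡ ⟩
      p * (p ℕ.^ a * l)  ≡⟨ ℕ.*-assoc p _ l ⟨
      p * p ℕ.^ a * l    ∎) , p∤l
    where open ≡.≡-Reasoning

prime∤⇒coprime : ∀ {p m} → Prime p → p ∤ m → Coprime p m
prime∤⇒coprime pr p∤m (d∣p , d∣m) with prime⇒irreducible pr d∣p
... | inj₁ d≡1    = d≡1
... | inj₂ ≡.refl = contradiction d∣m p∤m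

coprime-^ˡ : ∀ {p m} → Coprime p m → ∀ a → Coprime (p ℕ.^ a) m
coprime-^ˡ co zero    (d∣1 , _)      = ∣1⇒≡1 d∣1
coprime-^ˡ co (suc a) (d∣p^1+a , d∣m) =
  coprime-^ˡ co a (coprime-divisor (λ (e∣d , e∣p) → co (e∣p , ∣-trans e∣d d∣m)) d∣p^1+a , d∣m)

coprime-*-∣ : ∀ {m n s} → Coprime m n → m ∣ s → n ∣ s → m * n ∣ s
coprime-*-∣ {m} {n} co (divides-refl t) n∣tm =
  ≡.subst (m * n ∣_) (ℕ.*-comm m t)
    (*-monoʳ-∣ m (coprime-divisor (Coprimality.sym co) (≡.subst (n ∣_) (ℕ.*-comm t m) n∣tm)))

∣-<⇒≡0 : ∀ {n s} → n ∣ s → s < n → s ≡ 0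
∣-<⇒≡0 {s = zero}  _   _   = ≡.refl
∣-<⇒≡0 {s = suc _} n∣s s<n = contradiction (∣⇒≤ n∣s) (ℕ.<⇒≱ s<n)

entry∣∏ : ∀ {r} (k : Vector ℕ r) i → k i ∣ ∏ k
entry∣∏ k zero    = m∣m*n _
entry∣∏ k (suc i) = ∣n⇒∣m*n (k zero) (entry∣∏ (k ∘ suc) i)

odd-∏ : ∀ {r} (k : Vector ℕ r) → (∀ i → 2 ∤ k i) → 2 ∤ ∏ k
odd-∏ {zero}  k odd 2∣1 = contradiction (∣1⇒≡1 2∣1) λ ()
odd-∏ {suc r} k odd 2∣∏ =
  [ odd zero , odd-∏ (k ∘ suc) (odd ∘ suc) ]′ (euclidsLemma (k zero) _ prime[2] 2∣∏)

-- Powers and cancellation in a field.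

module FieldProperties {c ℓ} (F : Field c ℓ) where
  open Field F using (commutativeRing; 0≉1; inverse) public
  open CommutativeRing commutativeRing hiding (_-_; zero)
    renaming (_+_ to _⊕_; _*_ to _·_; *-cong to ·-cong) public
  open CommutativeSemiringExp commutativeSemiring public
  open RingProperties ring using (-1*x≈-x; -‿involutive; +-inverseˡ-unique; +-cancelʳ) public
  open import Relation.Binary.Reasoning.Setoid setoid

  ·-cancelˡ : ∀ {x y z} → x ≉ 0# → x · y ≈ x · z → y ≈ z
  ·-cancelˡ {x} {y} {z} x≉0 xy≈xz with inverse x x≉0
  ... | x⁻¹ , xx⁻¹≈1 = trans (sym (undo y)) (trans (*-congˡ xy≈xz) (undo z))
    where
    undo : ∀ t → x⁻¹ · (x · t) ≈ t
    undo t = begin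
      x⁻¹ · (x · t)  ≈⟨ *-assoc _ _ _ ⟨
      x⁻¹ · x · t    ≈⟨ *-congʳ (trans (*-comm _ _) xx⁻¹≈1) ⟩
      1# · t         ≈⟨ *-identityˡ t ⟩
      t              ∎

  ·-cancelʳ : ∀ {x y z} → x ≉ 0# → y · x ≈ z · x → y ≈ z
  ·-cancelʳ x≉0 yx≈zx = ·-cancelˡ x≉0 (trans (*-comm _ _) (trans yx≈zx (*-comm _ _)))

  1≉0 : 1# ≉ 0#
  1≉0 = 0≉1 ∘ sym

  ·-≉0 : ∀ {x y} → x ≉ 0# → y ≉ 0# → x · y ≉ 0#
  ·-≉0 x≉0 y≉0 xy≈0 = y≉0 (·-cancelˡ x≉0 (trans xy≈0 (sym (zeroʳ _))))

  ^-≉0 : ∀ {x} n → x ≉ 0# → x ^ n ≉ 0#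
  ^-≉0 zero    x≉0 = 1≉0
  ^-≉0 (suc n) x≉0 = ·-≉0 x≉0 (^-≉0 n x≉0)

  1^n≈1 : ∀ n → 1# ^ n ≈ 1#
  1^n≈1 zero    = refl
  1^n≈1 (suc n) = trans (*-identityˡ _) (1^n≈1 n)

  ^≈1-∣ : ∀ {x n s} → x ^ n ≈ 1# → n ∣ s → x ^ s ≈ 1#
  ^≈1-∣ {x} {n} x^n≈1 (divides-refl t) = begin
    x ^ (t * n)  ≈⟨ ^-congʳ x (ℕ.*-comm t n) ⟩
    x ^ (n * t)  ≈⟨ ^-assocʳ x n t ⟨
    (x ^ n) ^ t  ≈⟨ ^-congˡ t x^n≈1 ⟩
    1# ^ t       ≈⟨ 1^n≈1 t ⟩
    1#           ∎

  ^≈1-cancelʳ : ∀ {x} d e → x ^ (d + e) ≈ 1# → x ^ e ≈ 1# → x ^ d ≈ 1#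
  ^≈1-cancelʳ {x} d e x^[d+e]≈1 x^e≈1 = begin
    x ^ d          ≈⟨ *-identityʳ _ ⟨
    x ^ d · 1#     ≈⟨ *-congˡ x^e≈1 ⟨
    x ^ d · x ^ e  ≈⟨ ^-homo-* x d e ⟨
    x ^ (d + e)    ≈⟨ x^[d+e]≈1 ⟩
    1#             ∎

  -- Bézout expresses `d` as a difference of multiples of `m` and `n`. Keeping the subtracted
  -- multiple on the side of `d` leaves all exponents natural, and its power of `x`, being 1,
  -- cancels.
  ^≈1-Bézout : ∀ {x d m n} → Bézout.Identity d m n → x ^ m ≈ 1# → x ^ n ≈ 1# → x ^ d ≈ 1#
  ^≈1-Bézout {x} {d} {m} {n} (Bézout.+- s t eq) x^m≈1 x^n≈1 =
    ^≈1-cancelʳ d (t * n)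
      (trans (^-congʳ x eq) (^≈1-∣ x^m≈1 (n∣m*n s))) (^≈1-∣ x^n≈1 (n∣m*n t))
  ^≈1-Bézout {x} {d} {m} {n} (Bézout.-+ s t eq) x^m≈1 x^n≈1 =
    ^≈1-cancelʳ d (s * m)
      (trans (^-congʳ x eq) (^≈1-∣ x^n≈1 (n∣m*n t))) (^≈1-∣ x^m≈1 (n∣m*n s))

  -- The quotient of `x` by `y` has `m`-th and `n`-th power 1, so Bézout for the gcd 1 makes it 1.
  -- This is why blocks of different classes share at most one point.
  coprime-^-injective : ∀ {m n x y} → Coprime m n → y ≉ 0# → x ^ m ≈ y ^ m → x ^ n ≈ y ^ n → x ≈ y
  coprime-^-injective {m} {n} {x} {y} co y≉0 x^m≈y^m x^n≈y^n with inverse y y≉0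
  ... | y⁻¹ , yy⁻¹≈1 = ·-cancelʳ y⁻¹≉0 (trans xy⁻¹≈1 (sym yy⁻¹≈1))
    where
    quotient^≈1 : ∀ e → x ^ e ≈ y ^ e → (x · y⁻¹) ^ e ≈ 1#
    quotient^≈1 e x^e≈y^e = begin
      (x · y⁻¹) ^ e    ≈⟨ ^-distrib-* x y⁻¹ e ⟩
      x ^ e · y⁻¹ ^ e  ≈⟨ *-congʳ x^e≈y^e ⟩
      y ^ e · y⁻¹ ^ e  ≈⟨ ^-distrib-* y y⁻¹ e ⟨
      (y · y⁻¹) ^ e    ≈⟨ ^-congˡ e yy⁻¹≈1 ⟩
      1# ^ e           ≈⟨ 1^n≈1 e ⟩
      1#               ∎
    xy⁻¹≈1 : x · y⁻¹ ≈ 1#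
    xy⁻¹≈1 = trans (sym (*-identityʳ _))
      (^≈1-Bézout (coprime-Bézout co) (quotient^≈1 m x^m≈y^m) (quotient^≈1 n x^n≈y^n))
    y⁻¹≉0 : y⁻¹ ≉ 0#
    y⁻¹≉0 y⁻¹≈0 = 1≉0 (trans (sym yy⁻¹≈1) (trans (*-congˡ y⁻¹≈0) (zeroʳ y)))

  -^-odd : ∀ x m → (- x) ^ (m * 2 + 1) ≈ - (x ^ (m * 2 + 1))
  -^-odd x m = begin
    (- x) ^ n                  ≈⟨ ^-congˡ n (-1*x≈-x x) ⟨
    (- 1# · x) ^ n             ≈⟨ ^-distrib-* (- 1#) x n ⟩
    (- 1#) ^ n · x ^ n         ≈⟨ *-congʳ -1^n≈-1 ⟩
    - 1# · x ^ n               ≈⟨ -1*x≈-x _ ⟩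
    - (x ^ n)                  ∎
    where
    n = m * 2 + 1
    -1²≈1 : (- 1#) ^ 2 ≈ 1#
    -1²≈1 = trans (*-congˡ (*-identityʳ _)) (trans (-1*x≈-x _) (-‿involutive 1#))
    -1^n≈-1 : (- 1#) ^ n ≈ - 1#
    -1^n≈-1 = begin
      (- 1#) ^ n                        ≈⟨ ^-homo-* (- 1#) (m * 2) 1 ⟩
      (- 1#) ^ (m * 2) · (- 1#) ^ 1     ≈⟨ ·-cong (^≈1-∣ -1²≈1 (n∣m*n m)) (*-identityʳ _) ⟩
      1# · - 1#                         ≈⟨ *-identityˡ _ ⟩
      - 1#                              ∎

  -- Multiplicative orders.

  -- Minimality is taken with respect to divisibility, the form in which coprime orders can be
  -- multiplied.
  HasOrder : Carrier → ℕ → Set ℓ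
  HasOrder w n = w ^ n ≈ 1# × (∀ s → w ^ s ≈ 1# → n ∣ s)

  1-hasOrder : HasOrder 1# 1
  1-hasOrder = *-identityʳ _ , λ s _ → 1∣ s

  hasOrder⇒≉0 : ∀ {w n} → .{{NonZero n}} → HasOrder w n → w ≉ 0#
  hasOrder⇒≉0 {w} {suc n} (w^n≈1 , _) w≈0 = 1≉0 (trans (sym w^n≈1) (trans (*-congʳ w≈0) (zeroˡ _)))

  -- Raising to the power `n` removes `y`: from `(x · y) ^ (n * s) ≈ 1` follows `x ^ (n * s) ≈ 1`,
  -- so `m` divides `n * s`, and coprimality removes `n`.
  order-∣-· : ∀ {x y m n} s → Coprime m n → HasOrder x m → y ^ n ≈ 1# → (x · y) ^ s ≈ 1# → m ∣ s
  order-∣-· {x} {y} {m} {n} s co (_ , least) y^n≈1 xy^s≈1 = coprime-divisor co (least (n * s) (begin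
    x ^ (n * s)                ≈⟨ *-identityʳ _ ⟨
    x ^ (n * s) · 1#           ≈⟨ *-congˡ (^≈1-∣ {n = n} y^n≈1 (m∣m*n s)) ⟨
    x ^ (n * s) · y ^ (n * s)  ≈⟨ ^-distrib-* x y (n * s) ⟨
    (x · y) ^ (n * s)          ≈⟨ ^≈1-∣ {n = s} xy^s≈1 (n∣m*n n) ⟩
    1#                         ∎))

  hasOrder-· : ∀ {x y m n} → Coprime m n → HasOrder x m → HasOrder y n → HasOrder (x · y) (m * n)
  hasOrder-· {x} {y} {m} {n} co x-ord@(x^m≈1 , _) y-ord@(y^n≈1 , _) =
    (begin
      (x · y) ^ (m * n)          ≈⟨ ^-distrib-* x y (m * n) ⟩
      x ^ (m * n) · y ^ (m * n)  ≈⟨ ·-cong (^≈1-∣ {n = m} x^m≈1 (m∣m*n n)) (^≈1-∣ {n = n} y^n≈1 (n∣m*n m)) ⟩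
      1# · 1#                    ≈⟨ *-identityˡ 1# ⟩
      1#                         ∎)
    , λ s xy^s≈1 → coprime-*-∣ co
        (order-∣-· s co x-ord y^n≈1 xy^s≈1)
        (order-∣-· s (Coprimality.sym co) y-ord x^m≈1 (trans (^-congˡ s (*-comm y x)) xy^s≈1))

  -- If `x ^ s ≈ 1`, then also `x ^ d ≈ 1` for the gcd `d` of `s` and `p ^ (1 + a)`. A proper
  -- divisor of `p ^ (1 + a)` divides `p ^ a`, which the second hypothesis forbids; hence `d` is the
  -- whole prime power.
  hasOrder-primePower : ∀ {p x} a → Prime p →
    x ^ (p ℕ.^ suc a) ≈ 1# → x ^ (p ℕ.^ a) ≉ 1# → HasOrder x (p ℕ.^ suc a)
  hasOrder-primePower {p} {x} a pr x^p^[1+a]≈1 x^p^a≉1 = x^p^[1+a]≈1 , least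
    where
    instance _ = prime⇒nonZero pr
    n = p ℕ.^ suc a
    least : ∀ s → x ^ s ≈ 1# → n ∣ s
    least s x^s≈1 with gcd s n in eq | gcd[m,n]∣m s n | gcd[m,n]∣n s n
                     | ^≈1-Bézout (Bézout.identity (gcd-GCD s n)) x^s≈1 x^p^[1+a]≈1
    ... | d | d∣s | divides e n≡ed | x^d≈1 = ≡.subst (_∣ s) d≡n d∣s
      where
      p∤e : p ∤ e
      p∤e (divides-refl f) = x^p^a≉1 (^≈1-∣ x^d≈1 (divides f (ℕ.*-cancelˡ-≡ _ _ p
        (≡.trans n≡ed (≡.trans (≡.cong (_* d) (ℕ.*-comm f p)) (ℕ.*-assoc p f d))))))
      e≡1 : e ≡ 1
      -- The cofactor `e` divides a power of `p` and is prime to it, so it is a common divisor of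
      -- coprime numbers.
      e≡1 = coprime-^ˡ (prime∤⇒coprime pr p∤e) (suc a)
        (≡.subst (e ∣_) (≡.sym n≡ed) (m∣m*n d) , ∣-refl)
      d≡n : d ≡ n
      d≡n = ≡.trans (≡.sym (ℕ.*-identityˡ d)) (≡.trans (≡.cong (_* d) (≡.sym e≡1)) (≡.sym n≡ed))

  -- Equal powers give `w ^ (t ∸ s) ≈ 1` for the smaller exponent `s`; the order divides this
  -- difference but exceeds it, so the difference is 0.
  hasOrder-^-injective : ∀ {w n s t} → HasOrder w n → s < n → t < n → w ^ s ≈ w ^ t → s ≡ t
  hasOrder-^-injective {w} {n@(suc _)} {s} {t} ord@(_ , least) s<n t<n w^s≈w^t =
    [ (λ s≤t → ordered s≤t t<n w^s≈w^t)
    , (λ t≤s → ≡.sym (ordered t≤s s<n (sym w^s≈w^t))) ]′ (ℕ.≤-total s t)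
    where
    ordered : ∀ {s t} → s ≤ t → t < n → w ^ s ≈ w ^ t → s ≡ t
    ordered {s} {t} s≤t t<n w^s≈w^t = ℕ.≤-antisym s≤t (ℕ.m∸n≡0⇒m≤n
      (∣-<⇒≡0 (least (t ∸ s) w^[t-s]≈1) (ℕ.≤-<-trans (ℕ.m∸n≤m t s) t<n)))
      where
      w^[t-s]≈1 : w ^ (t ∸ s) ≈ 1#
      w^[t-s]≈1 = ·-cancelˡ (^-≉0 s (hasOrder⇒≉0 ord)) (begin
        w ^ s · w ^ (t ∸ s)  ≈⟨ ^-homo-* w s (t ∸ s) ⟨
        w ^ (s + (t ∸ s))    ≈⟨ ^-congʳ w (ℕ.m+[n∸m]≡n s≤t) ⟩
        w ^ t                ≈⟨ w^s≈w^t ⟨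
        w ^ s                ≈⟨ *-identityʳ _ ⟨
        w ^ s · 1#           ∎)

  -- Monic polynomials and geometric sums.

  -- A vector c₀ ∷ … ∷ c_{d-1} stands for the monic polynomial c₀ + … + c_{d-1} X^{d-1} + X^d.
  evalMonic : ∀ {d} → Vec Carrier d → Carrier → Carrier
  evalMonic []       x = 1#
  evalMonic (c ∷ cs) x = c ⊕ x · evalMonic cs x

  module Solver = NaturalCoefficients commutativeSemiring

  -- Division by X - a, with the negative terms moved across so that no subtraction occurs.
  divideMonic : ∀ {d} (cs : Vec Carrier (suc d)) a → ∃ λ (ds : Vec Carrier d) → ∀ x →
    evalMonic cs x ⊕ a · evalMonic ds x ≈ evalMonic cs a ⊕ x · evalMonic ds x
  divideMonic {zero} (c ∷ []) a = [] , λ x →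
    solve 4 (λ c x a u → (c :+ x :* u) :+ a :* u := (c :+ a :* u) :+ x :* u) refl c x a 1#
    where open Solver
  divideMonic {suc d} (c ∷ cs) a with divideMonic cs a
  ... | ds , identity = evalMonic cs a ∷ ds , λ x →
    let P = evalMonic cs x
        Q = evalMonic cs a
        D = evalMonic ds x
    in begin
      (c ⊕ x · P) ⊕ a · (Q ⊕ x · D)    ≈⟨ solve 6 (λ c x a P Q D →
            (c :+ x :* P) :+ a :* (Q :+ x :* D) := (c :+ a :* Q) :+ x :* (P :+ a :* D)) refl c x a P Q D ⟩
      (c ⊕ a · Q) ⊕ x · (P ⊕ a · D)    ≈⟨ +-congˡ (*-congˡ (identity x)) ⟩
      (c ⊕ a · Q) ⊕ x · (Q ⊕ x · D)    ∎
    where open Solver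

  -- The telescoping identity for a geometric sum, with negative terms moved across. The first term
  -- `a` is arbitrary because the induction passes to the tail, which starts at `a · h`.
  geometricSum : ∀ k a h →
    let S = CommutativeMonoidSum.sum +-commutativeMonoid {k} (λ j → a · h ^ toℕ j)
    in S · h ⊕ a ≈ S ⊕ a · h ^ k
  geometricSum zero a h = solve 2 (λ h a → con 0 :* h :+ a := con 0 :+ a :* con 1) refl h a
    where open Solver
  geometricSum (suc k) a h = begin
    (a · 1# ⊕ T) · h ⊕ a            ≈⟨ +-congʳ (*-congʳ (+-congˡ T≈S)) ⟩
    (a · 1# ⊕ S) · h ⊕ a            ≈⟨ solve 3 (λ a S h →
        (a :* con 1 :+ S) :* h :+ a := a :* con 1 :+ (S :* h :+ a :* h)) refl a S h ⟩
    a · 1# ⊕ (S · h ⊕ a · h)        ≈⟨ +-congˡ (geometricSum k (a · h) h) ⟩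
    a · 1# ⊕ (S ⊕ a · h · h ^ k)    ≈⟨ +-assoc _ _ _ ⟨
    a · 1# ⊕ S ⊕ a · h · h ^ k      ≈⟨ +-cong (+-congˡ (sym T≈S)) (*-assoc _ _ _) ⟩
    a · 1# ⊕ T ⊕ a · (h · h ^ k)    ∎
    where
    open Solver
    open CommutativeMonoidSum +-commutativeMonoid
    S = sum {k} (λ j → a · h · h ^ toℕ j)
    T = sum {k} (λ j → a · (h · h ^ toℕ j))
    T≈S : T ≈ S
    T≈S = sum-cong-≋ {k} (λ j → sym (*-assoc a h (h ^ toℕ j)))

-- Root counting and Fermat's theorem in a finite field.

module FiniteField {c ℓ} (F : Field c ℓ) {n} (card : HasCardinality (Field.setoid F) (suc n)) where
  open FieldProperties F public
  open Inverse card using (to; from; to-cong; from-cong; strictlyInverseˡ; strictlyInverseʳ)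
  open import Relation.Binary.Reasoning.Setoid setoid

  to-injective : ∀ {x y} → to x ≡ to y → x ≈ y
  to-injective {x} {y} eq = begin
    x            ≈⟨ strictlyInverseʳ x ⟨
    from (to x)  ≈⟨ from-cong eq ⟩
    from (to y)  ≈⟨ strictlyInverseʳ y ⟩
    y            ∎

  from-injective : ∀ {i j} → from i ≈ from j → i ≡ j
  from-injective {i} {j} eq =
    ≡.trans (≡.sym (strictlyInverseˡ i)) (≡.trans (to-cong eq) (strictlyInverseˡ j))

  infix 4 _≟_
  _≟_ : Decidable _≈_
  x ≟ y = map′ to-injective to-cong (to x Fin.≟ to y)

  -- Dividing by `X - e zero` lowers the degree by one, and every other listed root remains a root
  -- of the quotient.
  rootBound : ∀ {m d} (cs : Vec Carrier d) (e : Vector Carrier m) → Injective _≡_ _≈_ e →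
              (∀ i → evalMonic cs (e i) ≈ 0#) → m ≤ d
  rootBound {zero}           cs e e-inj roots = z≤n
  rootBound {suc m} {zero}   [] e e-inj roots = contradiction (roots zero) 1≉0
  rootBound {suc m} {suc d}  cs e e-inj roots with divideMonic cs (e zero)
  ... | ds , identity = s≤s (rootBound ds (e ∘ suc) (Fin.suc-injective ∘ e-inj) roots′)
    where
    roots′ : ∀ i → evalMonic ds (e (suc i)) ≈ 0#
    roots′ i with evalMonic ds (e (suc i)) ≟ 0#
    ... | yes D≈0 = D≈0
    -- Both polynomial values in the division identity vanish, so cancelling the nonzero quotient
    -- value would identify two distinct roots.
    ... | no  D≉0 = contradiction (e-inj (·-cancelʳ D≉0 a·D≈x·D)) λ ()
      where
      a·D≈x·D : e zero · evalMonic ds (e (suc i)) ≈ e (suc i) · evalMonic ds (e (suc i))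
      a·D≈x·D = begin
        e zero · D                             ≈⟨ +-identityˡ _ ⟨
        0# ⊕ e zero · D                      ≈⟨ +-congʳ (roots (suc i)) ⟨
        evalMonic cs (e (suc i)) ⊕ e zero · D  ≈⟨ identity (e (suc i)) ⟩
        evalMonic cs (e zero) ⊕ e (suc i) · D  ≈⟨ +-congʳ (roots zero) ⟩
        0# ⊕ e (suc i) · D                   ≈⟨ +-identityˡ _ ⟩
        e (suc i) · D                        ∎
        where D = evalMonic ds (e (suc i))

  unityRootBound : ∀ {m} d → .{{NonZero d}} → (e : Vector Carrier m) → Injective _≡_ _≈_ e →
                   (∀ i → e i ^ d ≈ 1#) → m ≤ d
  -- The coefficient vector encodes `X ^ (1 + d) - 1`; the leading coefficient is implicit.
  unityRootBound (suc d) e e-inj e^d≈1 = rootBound (- 1# ∷ replicate d 0#) e e-inj λ i → begin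
    - 1# ⊕ e i · evalMonic (replicate d 0#) (e i)  ≈⟨ +-congˡ (*-congˡ (eval-X^ d (e i))) ⟩
    - 1# ⊕ e i · e i ^ d                           ≈⟨ +-congˡ (e^d≈1 i) ⟩
    - 1# ⊕ 1#                                      ≈⟨ -‿inverseˡ 1# ⟩
    0#                                             ∎
    where
    eval-X^ : ∀ d x → evalMonic (replicate d 0#) x ≈ x ^ d
    eval-X^ zero    x = refl
    eval-X^ (suc d) x = trans (+-identityˡ _) (*-congˡ (eval-X^ d x))

  -- `punchIn` skips the index of zero, so this lists all `n` nonzero elements.
  unit : Vector Carrier n
  unit i = from (punchIn (to 0#) i)

  unit-injective : Injective _≡_ _≈_ unit
  unit-injective = Fin.punchIn-injective (to 0#) _ _ ∘ from-injective

  unit≉0 : ∀ i → unit i ≉ 0#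
  unit≉0 i unit≈0 =
    Fin.punchInᵢ≢i (to 0#) i (≡.trans (≡.sym (strictlyInverseˡ _)) (to-cong unit≈0))

  private module Product = CommutativeMonoidSum *-commutativeMonoid

  product-≉0 : ∀ {m} (e : Vector Carrier m) → (∀ i → e i ≉ 0#) → Product.sum e ≉ 0#
  product-≉0 {zero}  e e≉0 = 1≉0
  product-≉0 {suc m} e e≉0 = ·-≉0 (e≉0 zero) (product-≉0 (e ∘ suc) (e≉0 ∘ suc))

  -- Multiplication by x permutes the nonzero elements, so it does not change their product.
  fermat : ∀ {x} → x ≉ 0# → x ^ n ≈ 1#
  fermat {x} x≉0 with inverse x x≉0
  ... | x⁻¹ , xx⁻¹≈1 = sym (·-cancelʳ (product-≉0 unit unit≉0) (begin
    1# · Product.sum unit                                  ≈⟨ *-identityˡ _ ⟩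
    Product.sum unit                                       ≈⟨ Product.sum-permute unit σ ⟩
    Product.sum (λ i → unit (σ Perm.⟨$⟩ʳ i))               ≈⟨ Product.sum-cong-≋ unit-σ ⟩
    Product.sum (λ i → x · unit i)                         ≈⟨ Product.∑-distrib-+ (λ _ → x) unit ⟩
    Product.sum (Vector.replicate n x) · Product.sum unit  ≈⟨ *-congʳ (Product.sum-replicate n) ⟩
    x ^ n · Product.sum unit                               ∎))
    where
    scale-cancel : ∀ y z → y · z ≈ 1# → ∀ i → to (y · from (to (z · from i))) ≡ i
    scale-cancel y z yz≈1 i = ≡.trans (to-cong (begin
      y · from (to (z · from i))  ≈⟨ *-congˡ (strictlyInverseʳ _) ⟩
      y · (z · from i)            ≈⟨ *-assoc _ _ _ ⟨
      y · z · from i              ≈⟨ *-congʳ yz≈1 ⟩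
      1# · from i                 ≈⟨ *-identityˡ _ ⟩
      from i                      ∎)) (strictlyInverseˡ i)
    π : Perm.Permutation (suc n) (suc n)
    π = Perm.permutation (λ i → to (x · from i)) (λ i → to (x⁻¹ · from i))
          (scale-cancel x x⁻¹ xx⁻¹≈1) (scale-cancel x⁻¹ x (trans (*-comm _ _) xx⁻¹≈1))
    π-0 : π Perm.⟨$⟩ʳ to 0# ≡ to 0#
    π-0 = to-cong (trans (*-congˡ (strictlyInverseʳ 0#)) (zeroʳ x))
    -- Since `π` fixes the index of zero, deleting that index leaves a permutation of the nonzero
    -- elements.
    σ : Perm.Permutation n n
    σ = Perm.remove (to 0#) π
    unit-σ : ∀ i → unit (σ Perm.⟨$⟩ʳ i) ≈ x · unit i
    unit-σ i = begin
      from (punchIn (to 0#) (σ Perm.⟨$⟩ʳ i))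
        ≈⟨ from-cong (≡.cong (λ z → punchIn z (σ Perm.⟨$⟩ʳ i)) π-0) ⟨
      from (punchIn (π Perm.⟨$⟩ʳ to 0#) (σ Perm.⟨$⟩ʳ i))
        ≈⟨ from-cong (Perm.punchIn-permute π (to 0#) i) ⟨
      from (to (x · unit i))
        ≈⟨ strictlyInverseʳ _ ⟩
      x · unit i ∎

  -- Existence of elements of prescribed order.

  -- The `n` units cannot all be among the at most `d` roots of `X ^ d - 1`; equality is decidable,
  -- so a finite search finds an exception.
  ∃-^≉1 : ∀ d → .{{NonZero d}} → d < n → ∃ λ x → x ≉ 0# × x ^ d ≉ 1#
  ∃-^≉1 d d<n with Fin.¬∀⟶∃¬ n (λ i → unit i ^ d ≈ 1#) (λ i → unit i ^ d ≟ 1#)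
                     (ℕ.<⇒≱ d<n ∘ unityRootBound d unit unit-injective)
  ... | i , x^d≉1 = unit i , unit≉0 i , x^d≉1

  -- With `n ≡ m * p ^ (1 + a)` and `d` equal to `n / p`, take `x` with `x ^ d ≉ 1`. The
  -- `p ^ (1 + a)`-th power of `x ^ m` is `x ^ n ≈ 1`, while its `p ^ a`-th power is `x ^ d`.
  ∃-hasPrimePowerOrder : .{{NonZero n}} → ∀ {p} → Prime p → ∀ a → p ℕ.^ a ∣ n →
                         ∃ λ x → HasOrder x (p ℕ.^ a)
  ∃-hasPrimePowerOrder pr zero    _ = 1# , 1-hasOrder
  ∃-hasPrimePowerOrder {p} pr (suc a) (divides m n≡mp^[1+a]) =
    let x , x≉0 , x^d≉1 = ∃-^≉1 d d<n in
    x ^ m , hasOrder-primePower a pr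
      (trans (^-assocʳ x m _) (trans (^-congʳ x (≡.sym n≡mp^[1+a])) (fermat x≉0)))
      (x^d≉1 ∘ trans (sym (^-assocʳ x m _)))
    where
    d = m * p ℕ.^ a
    n≡dp : n ≡ d * p
    n≡dp = ≡.trans n≡mp^[1+a] (≡.trans (≡.cong (m *_) (ℕ.*-comm p _)) (≡.sym (ℕ.*-assoc m _ p)))
    instance
      _ = prime⇒nonTrivial pr
      d≢0 : NonZero d
      d≢0 = ℕ.m*n≢0⇒m≢0 d {p} {{≡.subst NonZero n≡dp (ℕ.≢-nonZero (ℕ.≢-nonZero⁻¹ n))}}
    d<n : d < n
    d<n = ≡.subst (d <_) (≡.sym n≡dp) (ℕ.m<m*n d p (ℕ.nonTrivial⇒n>1 p))

  -- Strong induction on `m`: split off the full power of one prime divisor, and multiply an element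
  -- of that order by one whose order is the smaller, coprime cofactor.
  ∃-hasOrder : .{{NonZero n}} → ∀ m → m ∣ n → ∃ λ w → HasOrder w m
  ∃-hasOrder = <-rec (λ m → m ∣ n → ∃ λ w → HasOrder w m) step
    where
    step : ∀ m → (∀ {l} → l < m → l ∣ n → ∃ λ w → HasOrder w l) → m ∣ n → ∃ λ w → HasOrder w m
    step 0 rec 0∣n = contradiction (0∣⇒≡0 0∣n) (ℕ.≢-nonZero⁻¹ n)
    step 1 rec _   = 1# , 1-hasOrder
    step m@(suc (suc _)) rec m∣n with ∃-primeDivisor m (s≤s (s≤s z≤n))
    ... | p , pr , p∣m with splitPrimePart pr m
    ...   | zero , l , m≡l , p∤l = contradiction (≡.subst (p ∣_) (≡.trans m≡l (ℕ.*-identityˡ l)) p∣m) p∤l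
    ...   | suc a , l , m≡p^[1+a]l , p∤l =
      let x , x-ord = rec l<m (∣-trans (divides (p ℕ.^ suc a) m≡p^[1+a]l) m∣n)
          y , y-ord = ∃-hasPrimePowerOrder pr (suc a)
            (∣-trans (divides l (≡.trans m≡p^[1+a]l (ℕ.*-comm _ l))) m∣n)
      in y · x , ≡.subst (HasOrder (y · x)) (≡.sym m≡p^[1+a]l)
           (hasOrder-· (coprime-^ˡ (prime∤⇒coprime pr p∤l) (suc a)) y-ord x-ord)
      where
      instance
        _ = prime⇒nonZero pr
        _ = prime⇒nonTrivial pr
        l≢0 : NonZero l
        l≢0 = ℕ.m*n≢0⇒n≢0 (p ℕ.^ suc a) {l} {{≡.subst NonZero m≡p^[1+a]l _}}
      1<p^[1+a] : 1 < p ℕ.^ suc a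
      1<p^[1+a] = ℕ.<-≤-trans (ℕ.nonTrivial⇒n>1 p) (ℕ.m≤m*n p (p ℕ.^ a) {{ℕ.m^n≢0 p a}})
      l<m : l < m
      l<m = ≡.subst (l <_) (≡.trans (ℕ.*-comm l _) (≡.sym m≡p^[1+a]l)) (ℕ.m<m*n l _ 1<p^[1+a])

-- The half-set of `v`-th roots of unity.

module RootsOfUnity {c ℓ} (F : Field c ℓ) {v} (card : HasCardinality (Field.setoid F) (suc (2 * v)))
                    (v-odd : 2 ∤ v) (3≤v : 3 ≤ v) where
  open FiniteField F card public
  open import Relation.Binary.Reasoning.Setoid setoid

  private instance
    v≢0 : NonZero v
    v≢0 = ℕ.>-nonZero (ℕ.≤-trans (s≤s z≤n) 3≤v)
    2v≢0 : NonZero (2 * v)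
    2v≢0 = ℕ.m*n≢0 2 v

  w : Carrier
  w = proj₁ (∃-hasOrder v (n∣m*n 2))

  w-order : HasOrder w v
  w-order = proj₂ (∃-hasOrder v (n∣m*n 2))

  w≉0 : w ≉ 0#
  w≉0 = hasOrder⇒≉0 w-order

  x²≈1⇒x≈±1 : ∀ {x} → x · x ≈ 1# → x ≈ 1# ⊎ x ≈ - 1#
  x²≈1⇒x≈±1 {x} xx≈1 with x ⊕ 1# ≟ 0#
  ... | yes x+1≈0 = inj₂ (+-inverseˡ-unique x 1# x+1≈0)
  ... | no  x+1≉0 = inj₁ (·-cancelˡ x+1≉0 (begin
    (x ⊕ 1#) · x     ≈⟨ distribʳ x x 1# ⟩
    x · x ⊕ 1# · x   ≈⟨ +-cong xx≈1 (*-identityˡ x) ⟩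
    1# ⊕ x           ≈⟨ +-comm 1# x ⟩
    x ⊕ 1#           ≈⟨ *-identityʳ _ ⟨
    (x ⊕ 1#) · 1#    ∎))

  -- By Fermat's theorem the square of `x ^ v` is 1.
  ^v≈±1 : ∀ {x} → x ≉ 0# → x ^ v ≈ 1# ⊎ x ^ v ≈ - 1#
  ^v≈±1 {x} x≉0 = x²≈1⇒x≈±1 (begin
    x ^ v · x ^ v         ≈⟨ *-congˡ (*-identityʳ _) ⟨
    (x ^ v) ^ 2           ≈⟨ ^-assocʳ x v 2 ⟩
    x ^ (v * 2)           ≈⟨ ^-congʳ x (ℕ.*-comm v 2) ⟩
    x ^ (2 * v)           ≈⟨ fermat x≉0 ⟩
    1#                    ∎)

  -- Otherwise all 2v units would be v-th roots of unity.
  -1≉1 : - 1# ≉ 1#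
  -1≉1 -1≈1 = ℕ.<⇒≱ (ℕ.m<m*n v 2 (s≤s (s≤s z≤n))) (≡.subst (_≤ v) (ℕ.*-comm 2 v)
    (unityRootBound v unit unit-injective λ i →
      [ id , (λ eq → trans eq -1≈1) ]′ (^v≈±1 (unit≉0 i))))

  -^v : ∀ x → (- x) ^ v ≈ - (x ^ v)
  -^v x = ≡.subst (λ m → (- x) ^ m ≈ - (x ^ m)) (≡.sym v≡) (-^-odd x (v ℕ./ 2))
    where
    odd-remainder : ∀ r → r < 2 → v ≡ r + v ℕ./ 2 * 2 → v ≡ v ℕ./ 2 * 2 + 1
    odd-remainder 0 _ eq = contradiction (divides (v ℕ./ 2) eq) v-odd
    odd-remainder 1 _ eq = ≡.trans eq (ℕ.+-comm 1 _)
    odd-remainder (suc (suc _)) (s≤s (s≤s ())) _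
    v≡ : v ≡ v ℕ./ 2 * 2 + 1
    v≡ = odd-remainder (v ℕ.% 2) (m%n<n v 2) (m≡m%n+[m/n]*n v 2)

  G = Field.+-abelianGroup F

  V : FinSubset G v
  V = record
    { elements = λ s → w ^ toℕ s
    ; distinct = Fin.toℕ-injective ∘ hasOrder-^-injective w-order (Fin.toℕ<n _) (Fin.toℕ<n _)
    }

  infix 4 _∈V _∉V
  _∈V _∉V : Carrier → Set ℓ
  x ∈V = _∈_ G x V
  x ∉V = _∉_ G x V

  ∈V⇒^v≈1 : ∀ {x} → x ∈V → x ^ v ≈ 1#
  ∈V⇒^v≈1 {x} (s , x≈w^s) = begin
    x ^ v             ≈⟨ ^-congˡ v x≈w^s ⟩
    (w ^ toℕ s) ^ v   ≈⟨ ^-assocʳ w (toℕ s) v ⟩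
    w ^ (toℕ s * v)   ≈⟨ ^≈1-∣ (proj₁ w-order) (n∣m*n (toℕ s)) ⟩
    1#                ∎

  -- The `v` powers of `w` already exhaust the roots that `X ^ v - 1` can have; a further root would
  -- make `1 + v` of them.
  ^v≈1⇒∈V : ∀ {x} → x ^ v ≈ 1# → x ∈V
  ^v≈1⇒∈V {x} x^v≈1 with Fin.any? (λ s → x ≟ w ^ toℕ s)
  ... | yes x∈V = x∈V
  ... | no  x∉V = contradiction (unityRootBound v e e-injective e^v≈1) ℕ.1+n≰n
    where
    e : Vector Carrier (suc v)
    e = x Vector.∷ FinSubset.elements V
    e-injective : Injective _≡_ _≈_ e
    e-injective {zero}  {zero}  _  = ≡.refl
    e-injective {zero}  {suc t} eq = contradiction (t , eq) x∉V
    e-injective {suc s} {zero}  eq = contradiction (s , sym eq) x∉V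
    e-injective {suc s} {suc t} eq = ≡.cong suc (FinSubset.distinct V eq)
    e^v≈1 : ∀ i → e i ^ v ≈ 1#
    e^v≈1 zero    = x^v≈1
    e^v≈1 (suc s) = ∈V⇒^v≈1 (s , refl)

  -- As `v` is odd, the `v`-th power of `- x` is -1, which differs from 1.
  ∈V⇒-∉V : ∀ {x} → x ∈V → - x ∉V
  ∈V⇒-∉V {x} x∈V -x∈V = -1≉1 (begin
    - 1#       ≈⟨ -‿cong (∈V⇒^v≈1 x∈V) ⟨
    - (x ^ v)  ≈⟨ -^v x ⟨
    (- x) ^ v  ≈⟨ ∈V⇒^v≈1 -x∈V ⟩
    1#         ∎)

  V-isHalfSet : HasCardinality setoid (2 * v + 1) → IsHalfSet G V
  V-isHalfSet order = record
    { order   = order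
    ; order≥7 = ℕ.+-monoˡ-≤ 1 (ℕ.*-monoʳ-≤ 2 3≤v)
    ; ε∉V     = λ (s , 0≈w^s) → ^-≉0 (toℕ s) w≉0 (sym 0≈w^s)
    ; oneOf±  = λ g g≉0 → oneOf g (^v≈±1 g≉0)
    }
    where
    oneOf : ∀ g → g ^ v ≈ 1# ⊎ g ^ v ≈ - 1# → (g ∈V × - g ∉V) ⊎ (g ∉V × - g ∈V)
    oneOf g (inj₁ g^v≈1) = inj₁ (g∈V , ∈V⇒-∉V g∈V)
      where g∈V = ^v≈1⇒∈V g^v≈1
    oneOf g (inj₂ g^v≈-1) = inj₂ ((λ g∈V → ∈V⇒-∉V g∈V -g∈V) , -g∈V)
      where
      -g∈V : - g ∈V
      -g∈V = ^v≈1⇒∈V (trans (-^v g) (trans (-‿cong g^v≈-1) (-‿involutive 1#)))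

  -- One parallel class: the cosets of a subgroup.

  -- The blocks are the cosets of the group of k-th roots of unity, generated by w ^ m.
  module Cosets {k m} (v≡km : v ≡ k * m) (2≤k : 2 ≤ k) where

    private
      w-order′ : HasOrder w (k * m)
      w-order′ = ≡.subst (HasOrder w) v≡km w-order

      instance
        m≢0 : NonZero m
        m≢0 = ℕ.m*n≢0⇒n≢0 k {m} {{≡.subst NonZero v≡km v≢0}}

    -- The exponent is `m * j + a`, so `a` selects the coset and `j` the position in it, and every
    -- exponent below `k * m` occurs exactly once.
    point : Fin k → Fin m → Carrier
    point j a = w ^ toℕ (combine j a)

    point-injective : ∀ {i j a b} → point i a ≈ point j b → i ≡ j × a ≡ b
    point-injective eq = Fin.combine-injective _ _ _ _
      (Fin.toℕ-injective (hasOrder-^-injective w-order′ (Fin.toℕ<n _) (Fin.toℕ<n _) eq))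

    point≈ : ∀ j a → point j a ≈ w ^ toℕ a · (w ^ m) ^ toℕ j
    point≈ j a = begin
      w ^ toℕ (combine j a)            ≈⟨ ^-congʳ w (Fin.toℕ-combine j a) ⟩
      w ^ (m * toℕ j + toℕ a)          ≈⟨ ^-homo-* w (m * toℕ j) (toℕ a) ⟩
      w ^ (m * toℕ j) · w ^ toℕ a      ≈⟨ *-congʳ (^-assocʳ w m (toℕ j)) ⟨
      (w ^ m) ^ toℕ j · w ^ toℕ a      ≈⟨ *-comm _ _ ⟩
      w ^ toℕ a · (w ^ m) ^ toℕ j      ∎

    w^m^k≈1 : (w ^ m) ^ k ≈ 1#
    w^m^k≈1 = trans (^-assocʳ w m k) (trans (^-congʳ w (ℕ.*-comm m k)) (proj₁ w-order′))

    w^m≉1 : w ^ m ≉ 1#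
    w^m≉1 w^m≈1 = ℕ.<⇒≱ (≡.subst (m <_) (ℕ.*-comm m k) (ℕ.m<m*n m k 2≤k))
      (∣⇒≤ (proj₂ w-order′ m w^m≈1))

    coset : Fin m → FinSubset G k
    coset a = record { elements = λ j → point j a ; distinct = proj₁ ∘ point-injective }

    -- Points of one coset differ by a `k`-th root of unity, which the `k`-th power sends to 1.
    coset-^k : ∀ {x y} a → _∈_ G x (coset a) → _∈_ G y (coset a) → x ^ k ≈ y ^ k
    coset-^k a x∈ y∈ = trans (^k≈ x∈) (sym (^k≈ y∈))
      where
      ^k≈ : ∀ {x} → _∈_ G x (coset a) → x ^ k ≈ (w ^ toℕ a) ^ k
      ^k≈ {x} (j , x≈) = begin
        x ^ k                                  ≈⟨ ^-congˡ k (trans x≈ (point≈ j a)) ⟩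
        (w ^ toℕ a · (w ^ m) ^ toℕ j) ^ k      ≈⟨ ^-distrib-* _ _ k ⟩
        (w ^ toℕ a) ^ k · ((w ^ m) ^ toℕ j) ^ k  ≈⟨ *-congˡ (^-assocʳ (w ^ m) (toℕ j) k) ⟩
        (w ^ toℕ a) ^ k · (w ^ m) ^ (toℕ j * k)  ≈⟨ *-congˡ (^≈1-∣ w^m^k≈1 (n∣m*n (toℕ j))) ⟩
        (w ^ toℕ a) ^ k · 1#                   ≈⟨ *-identityʳ _ ⟩
        (w ^ toℕ a) ^ k                        ∎

    -- Multiplication by `w ^ m` leaves the sum unchanged by the geometric identity, as
    -- `(w ^ m) ^ k ≈ 1`. A nonzero sum could be cancelled, forcing `w ^ m ≈ 1`.
    coset-sum : ∀ a → FinSubset.sum (coset a) ≈ 0#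
    coset-sum a with FinSubset.sum (coset a) ≟ 0#
    ... | yes S≈0 = S≈0
    ... | no  S≉0 = contradiction (·-cancelˡ S≉0 (begin
        S · w ^ m   ≈⟨ *-congʳ S≈T ⟩
        T · w ^ m   ≈⟨ Th≈T ⟩
        T           ≈⟨ S≈T ⟨
        S           ≈⟨ *-identityʳ S ⟨
        S · 1#      ∎)) w^m≉1
      where
      open CommutativeMonoidSum +-commutativeMonoid
      S = FinSubset.sum (coset a)
      T = sum {k} (λ j → w ^ toℕ a · (w ^ m) ^ toℕ j)
      S≈T : S ≈ T
      S≈T = sum-cong-≋ {k} (λ j → point≈ j a)
      Th≈T : T · w ^ m ≈ T
      Th≈T = +-cancelʳ (w ^ toℕ a) _ _ (begin
        T · w ^ m ⊕ w ^ toℕ a              ≈⟨ geometricSum k (w ^ toℕ a) (w ^ m) ⟩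
        T ⊕ w ^ toℕ a · (w ^ m) ^ k        ≈⟨ +-congˡ (*-congˡ w^m^k≈1) ⟩
        T ⊕ w ^ toℕ a · 1#                 ≈⟨ +-congˡ (*-identityʳ _) ⟩
        T ⊕ w ^ toℕ a                      ∎)

    heffterSystem : HeffterSystem G V k
    heffterSystem = record
      { size     = m
      ; block    = coset
      ; block⊆V  = λ a (j , x≈) → cast (≡.sym v≡km) (combine j a) ,
          trans x≈ (^-congʳ w (≡.sym (Fin.toℕ-cast (≡.sym v≡km) (combine j a))))
      ; covering = λ (s , x≈) →
          let j , a , eq = Fin.combine-surjective {k} {m} (cast v≡km s)
          in a , j , trans x≈ (^-congʳ w
               (≡.sym (≡.trans (≡.cong toℕ eq) (Fin.toℕ-cast v≡km s))))
      ; disjoint = λ a b (i , x≈) (j , x≈′) → proj₂ (point-injective (trans (sym x≈) x≈′))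
      ; zeroSum  = coset-sum
      }

-- Assembly of the Heffter space.

theorem3p2 : ∀ {c ℓ} (q v r : ℕ) (k : Vector ℕ r) →
    1 ≤ r →
    q ≡ 2 * v + 1 →
    IsPrimePower q →
    v ≡ ∏ k →
    PairwiseCoprime k →
    (∀ i → 2 ∤ k i) →
    (∀ i → 3 ≤ k i) →
    (F : Field c ℓ) →
    HasCardinality (Field.setoid F) q →
    HeffterSpace (Field.+-abelianGroup F) v k
theorem3p2 _ v r@(suc _) k _ ≡.refl _ ≡.refl coprime k-odd 3≤k F card = record
  { V             = V
  ; isHalfSet     = V-isHalfSet card
  ; parallelClass = class
  ; partialLinear = partialLinear
  }
  where
  v-odd : 2 ∤ ∏ k
  v-odd = odd-∏ k k-odd
  instance
    v≢0 : NonZero (∏ k)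
    v≢0 = ℕ.≢-nonZero λ v≡0 → v-odd (≡.subst (2 ∣_) (≡.sym v≡0) (2 ∣0))
  open RootsOfUnity F (≡.subst (HasCardinality (Field.setoid F)) (ℕ.+-comm (2 * v) 1) card)
         -- There is at least one class, so `v` is at least its first block size, hence at least 3.
         v-odd (ℕ.≤-trans (3≤k zero) (∣⇒≤ (entry∣∏ k zero)))
  module Class i = Cosets {k i} {quotient (entry∣∏ k i)}
    (≡.trans (_∣_.equality (entry∣∏ k i)) (ℕ.*-comm _ (k i))) (ℕ.<⇒≤ (3≤k i))
  class : ∀ i → HeffterSystem G V (k i)
  class i = Class.heffterSystem i

  partialLinear : ∀ {x y} → x ≉ y → (B C : Σ (Fin r) λ i → Fin (HeffterSystem.size (class i))) →
    _∈_ G x (Class.coset (proj₁ B) (proj₂ B)) → _∈_ G y (Class.coset (proj₁ B) (proj₂ B)) →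
    _∈_ G x (Class.coset (proj₁ C) (proj₂ C)) → _∈_ G y (Class.coset (proj₁ C) (proj₂ C)) → B ≡ C
  partialLinear x≉y (i , a) (j , b) x∈B y∈B x∈C y∈C with i Fin.≟ j
  ... | yes ≡.refl = ≡.cong (i ,_) (HeffterSystem.disjoint (class i) a b x∈B x∈C)
  -- For different classes, `x` and `y` agree in their `k i`-th and `k j`-th powers, and these
  -- exponents are coprime; `y` is nonzero as a power of `w`.
  ... | no  i≢j    = contradiction
    (coprime-^-injective (coprime i j i≢j)
      (λ y≈0 → ^-≉0 (toℕ (combine (proj₁ y∈B) a)) w≉0 (trans (sym (proj₂ y∈B)) y≈0))
      (Class.coset-^k i a x∈B y∈B) (Class.coset-^k j b x∈C y∈C))
    x≉y
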